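{- The following equalities of bimodal logics hold: 1. $\mathsf{K4}\times_d\mathsf{K4}=\langle\mathsf{K4},\mathsf{K4}\rangle$; 2. $\mathsf{K4}\times_d\mathsf{D4}=\langle\mathsf{K4},\mathsf{D4}\rangle$; 3. $\mathsf{D4}\times_d\mathsf{K4}=\langle\mathsf{D4},\mathsf{K4}\rangle$; 4. $\mathsf{D4}\times_d\mathsf{D4}=\mathsf{D4}*\mathsf{D4}$.
   Context: A (normal modal) logic is a set of modal formulas (built from propositional letters, $\bot$, $\to$, $\Box_i$) containing all classical tautologies and $\Box_i(p\to q)\to(\Box_i p\to\Box_i q)$, closed under substitution, modus ponens and $A/\Box_i A$. $\mathsf{K}_n$ is the minimal one with $n$ modalities, $\mathsf K=\mathsf K_1$, and $\mathsf{L}+\Gamma$ is the minimal logic containing $\mathsf{L}\cup\Gamma$. $\mathsf{K4}=\mathsf K+\Box p\to\Box\Box p$ and $\mathsf{D4}=\mathsf{K4}+\lnot\Box\bot$. A formula is closed if it contains no propositional letters. Fusion: $\mathsf{L}_1*\mathsf{L}_2=\mathsf{K}_2+\mathsf{L}_1'+\mathsf{L}_2'$, where $\mathsf{L}_i'$ is $\mathsf{L}_i$ with every $\Box$ replaced by $\Box_i$. Let $\Delta=\{B\to\Box_2B : B \text{ closed and } \Box_2\text{ -free}\}\cup\{B\to\Box_1B: B\text{ closed and }\Box_1\text{ -free}\}$ and $\langle \mathsf{L}_1,\mathsf{L}_2\rangle=\mathsf{L}_1*\mathsf{L}_2+\Delta$. A neighborhood frame (n-frame) is $(X,\tau)$ with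 $X\neq\varnothing$ and each $\tau(x)$ a filter on $X$ (possibly containing $\varnothing$); an n-2-frame $(X,\tau_1,\tau_2)$ has two such functions. For a valuation, $x\models\Box_iA$ iff there is $U\in\tau_i(x)$ with $y\models A$ for all $y\in U$; Boolean connectives as usual; validity means truth at all points under all valuations. Product of n-frames: $(X_1,\tau_1)\times(X_2,\tau_2)=(X_1\times X_2,\tau_1^h,\tau_2^v)$, where $\tau_1^h(x_1,x_2)=\{U: \exists V\in\tau_1(x_1)\ V\times\{x_2\}\subseteq U\}$ and $\tau_2^v(x_1,x_2)=\{U:\exists V\in\tau_2(x_2)\ \{x_1\}\times V\subseteq U\}$. Derivational semantics: for a topological space $\mathfrak X=(X,T)$ ($X\ne\varnothing$), let $\tau_d^{\mathfrak X}(x)=\{U\subseteq X: \exists U'\in T\ (x\in U',\ U'\setminus\{x\}\subseteq U)\}$ and $\mathcal N_d(\mathfrak X)=(X,\tau_d^{\mathfrak X})$. $\mathfrak X\models_d A$ means that $A$ is valid in the n-frame $\mathcal N_d(\mathfrak X)$; $\mathfrak X\models_d\mathsf L$ means $\mathfrak X\models_dA$ for all $A\in\mathsf L$. For the product of topological spaces (the bitopological product with horizontal and vertical topologies, not the Tychonoff product), $\mathfrak X_1\times\mathfrak X_2\models_dA$ means that the bimodal formula $A$ is valid in the n-2-frame $\mathcal N_d(\mathfrak X_1)\times\mathcal N_d(\mathfrak X_2)$. Finally, $\mathsf L_1\times_d\mathsf L_2$ is the set of all bimodal formulas $A$ such that $\mathfrak X_1\times\mathfrak X_2\models_dA$ for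 all topological spaces $\mathfrak X_1,\mathfrak X_2$ with $\mathfrak X_1\models_d\mathsf L_1$ and $\mathfrak X_2\models_d\mathsf L_2$. -}

module Defs where

open import Data.Bool using (Bool; true; false; not; _∨_)
open import Data.Empty using () renaming (⊥ to Absurd)
import Data.Empty.Polymorphic as Poly
open import Data.Fin using (Fin)
open import Data.Fin.Patterns using (0F; 1F)
open import Data.Nat using (ℕ)
open import Data.Product using (_×_; _,_; ∃-syntax)
open import Data.Unit using () renaming (⊤ to Unit)
open import Level using (Level; 0ℓ; suc; _⊔_; Lift)
open import Relation.Binary.PropositionalEquality using (_≡_; _≢_)
open import Relation.Unary using (Pred; _∈_; _⊆_; _≐_; _∩_; _∪_; _∖_; ∅; ｛_｝; ⋃; _⟨×⟩_)
import Relation.Unary.Polymorphic as PolySet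

private
  variable
    a b ℓ : Level
    m n : ℕ

------------------------------------------------------------------------
-- Formulas

infixr 5 _⇒_
infix  8 _[_]
infixr 7 □₁_ □₂_

data Formula (n : ℕ) : Set where
  var : ℕ → Formula n
  ⊥   : Formula n
  _⇒_ : Formula n → Formula n → Formula n
  □   : Fin n → Formula n → Formula n

-- In unimodal formulas □₁ plays the role of □.
pattern □₁_ A = □ 0F A
pattern □₂_ A = □ 1F A

¬ᶠ_ : Formula n → Formula n
¬ᶠ A = A ⇒ ⊥

_[_] : Formula n → (ℕ → Formula n) → Formula n
var p   [ σ ] = σ p
⊥       [ σ ] = ⊥
(A ⇒ B) [ σ ] = A [ σ ] ⇒ B [ σ ]
□ i A   [ σ ] = □ i (A [ σ ])

relabel : (Fin m → Fin n) → Formula m → Formula n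
relabel f (var p) = var p
relabel f ⊥       = ⊥
relabel f (A ⇒ B) = relabel f A ⇒ relabel f B
relabel f (□ i A) = □ (f i) (relabel f A)

Closed : Formula n → Set
Closed (var p) = Absurd
Closed ⊥       = Unit
Closed (A ⇒ B) = Closed A × Closed B
Closed (□ i A) = Closed A

BoxFree : Fin n → Formula n → Set
BoxFree i (var p) = Unit
BoxFree i ⊥       = Unit
BoxFree i (A ⇒ B) = BoxFree i A × BoxFree i B
BoxFree i (□ j A) = j ≢ i × BoxFree i A

-- Boolean evaluation in which boxed subformulas count as atoms.
eval : (Formula n → Bool) → Formula n → Bool
eval v (var p) = v (var p)
eval v ⊥       = false
eval v (A ⇒ B) = not (eval v A) ∨ eval v B
eval v (□ i A) = v (□ i A)

Tautology : Formula n → Set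
Tautology A = ∀ v → eval v A ≡ true

------------------------------------------------------------------------
-- Logics

record IsLogic {n : ℕ} (L : Pred (Formula n) ℓ) : Set ℓ where
  field
    taut : ∀ {A} → Tautology A → A ∈ L
    dist : ∀ i → (□ i (var 0 ⇒ var 1) ⇒ □ i (var 0) ⇒ □ i (var 1)) ∈ L
    sub  : ∀ {A} σ → A ∈ L → (A [ σ ]) ∈ L
    mp   : ∀ {A B} → (A ⇒ B) ∈ L → A ∈ L → B ∈ L
    nec  : ∀ {A} i → A ∈ L → □ i A ∈ L

data Least {n : ℕ} (Γ : Pred (Formula n) ℓ) : Pred (Formula n) ℓ where
  ax   : ∀ {A} → A ∈ Γ → A ∈ Least Γ
  taut : ∀ {A} → Tautology A → A ∈ Least Γ
  dist : ∀ i → (□ i (var 0 ⇒ var 1) ⇒ □ i (var 0) ⇒ □ i (var 1)) ∈ Least Γ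
  sub  : ∀ {A} σ → A ∈ Least Γ → (A [ σ ]) ∈ Least Γ
  mp   : ∀ {A B} → (A ⇒ B) ∈ Least Γ → A ∈ Least Γ → B ∈ Least Γ
  nec  : ∀ {A} i → A ∈ Least Γ → □ i A ∈ Least Γ

Least-isLogic : (Γ : Pred (Formula n) ℓ) → IsLogic (Least Γ)
Least-isLogic Γ = record { taut = taut ; dist = dist ; sub = sub ; mp = mp ; nec = nec }

Least-minimal : {Γ : Pred (Formula n) a} {L : Pred (Formula n) b} →
                IsLogic L → Γ ⊆ L → Least Γ ⊆ L
Least-minimal isL Γ⊆L (ax A∈Γ)  = Γ⊆L A∈Γ
Least-minimal isL Γ⊆L (taut t)  = IsLogic.taut isL t
Least-minimal isL Γ⊆L (dist i)  = IsLogic.dist isL i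
Least-minimal isL Γ⊆L (sub σ d) = IsLogic.sub isL σ (Least-minimal isL Γ⊆L d)
Least-minimal isL Γ⊆L (mp d e)  = IsLogic.mp isL (Least-minimal isL Γ⊆L d) (Least-minimal isL Γ⊆L e)
Least-minimal isL Γ⊆L (nec i d) = IsLogic.nec isL i (Least-minimal isL Γ⊆L d)

infixl 6 _+_
infixl 7 _*_

_+_ : Pred (Formula n) a → Pred (Formula n) b → Pred (Formula n) (a ⊔ b)
L + Γ = Least (L ∪ Γ)

Kₙ : (n : ℕ) → Pred (Formula n) 0ℓ
Kₙ n = Least ∅

K K4 D4 : Pred (Formula 1) 0ℓ
K  = Kₙ 1
K4 = K + ｛ □₁ var 0 ⇒ □₁ □₁ var 0 ｝
D4 = K4 + ｛ ¬ᶠ (□₁ ⊥) ｝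

rename : Fin n → Pred (Formula 1) a → Pred (Formula n) a
rename i L B = ∃[ A ] A ∈ L × B ≡ relabel (λ _ → i) A

_*_ : Pred (Formula 1) a → Pred (Formula 1) b → Pred (Formula 2) (a ⊔ b)
L₁ * L₂ = Kₙ 2 + rename 0F L₁ + rename 1F L₂

Δ : Pred (Formula 2) 0ℓ
Δ = (λ C → ∃[ B ] Closed B × BoxFree 1F B × C ≡ (B ⇒ □₂ B))
  ∪ (λ C → ∃[ B ] Closed B × BoxFree 0F B × C ≡ (B ⇒ □₁ B))

⟨_,_⟩ : Pred (Formula 1) a → Pred (Formula 1) b → Pred (Formula 2) (a ⊔ b)
⟨ L₁ , L₂ ⟩ = L₁ * L₂ + Δ

------------------------------------------------------------------------
-- Neighborhood semantics

-- Subsets of X : Set ℓ are elements of Pred X ℓ.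
Family : Set ℓ → Set (suc (suc ℓ))
Family {ℓ} X = Pred (Pred X ℓ) (suc ℓ)

record IsFilter {X : Set ℓ} (𝓕 : Family X) : Set (suc ℓ) where
  field
    whole  : PolySet.U ∈ 𝓕
    upward : ∀ {U V} → U ⊆ V → U ∈ 𝓕 → V ∈ 𝓕
    inter  : ∀ {U V} → U ∈ 𝓕 → V ∈ 𝓕 → (U ∩ V) ∈ 𝓕

-- n-frames are NFrame 1, n-2-frames are NFrame 2.
record NFrame (n : ℕ) (ℓ : Level) : Set (suc (suc ℓ)) where
  field
    Carrier  : Set ℓ
    point    : Carrier
    τ        : Fin n → Carrier → Family Carrier
    isFilter : ∀ i x → IsFilter (τ i x)

module _ (F : NFrame n ℓ) where
  open NFrame F

  Valuation : Set (suc ℓ)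
  Valuation = ℕ → Pred Carrier ℓ

  ⟦_⟧ : Formula n → Valuation → Pred Carrier (suc ℓ)
  ⟦ var p ⟧ V x = Lift (suc ℓ) (x ∈ V p)
  ⟦ ⊥ ⟧     V x = Poly.⊥
  ⟦ A ⇒ B ⟧ V x = x ∈ ⟦ A ⟧ V → x ∈ ⟦ B ⟧ V
  ⟦ □ i A ⟧ V x = ∃[ U ] U ∈ τ i x × U ⊆ ⟦ A ⟧ V

  Valid : Formula n → Set (suc ℓ)
  Valid A = ∀ V x → x ∈ ⟦ A ⟧ V

module _ (F₁ F₂ : NFrame 1 ℓ) where
  private
    module F₁ = NFrame F₁
    module F₂ = NFrame F₂

  τʰ τᵛ : F₁.Carrier × F₂.Carrier → Family (F₁.Carrier × F₂.Carrier)
  τʰ (x₁ , x₂) U = ∃[ V ] V ∈ F₁.τ 0F x₁ × (V ⟨×⟩ ｛ x₂ ｝) ⊆ U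
  τᵛ (x₁ , x₂) U = ∃[ V ] V ∈ F₂.τ 0F x₂ × (｛ x₁ ｝ ⟨×⟩ V) ⊆ U

  τʰ-isFilter : ∀ x → IsFilter (τʰ x)
  τʰ-isFilter (x₁ , _) = record
    { whole  = PolySet.U , whole , _
    ; upward = λ U⊆W (V , V∈τ , V⊆U) → V , V∈τ , λ z → U⊆W (V⊆U z)
    ; inter  = λ (V , V∈τ , V⊆U) (V′ , V′∈τ , V′⊆U′) →
        V ∩ V′ , inter V∈τ V′∈τ , λ ((v , v′) , e) → V⊆U (v , e) , V′⊆U′ (v′ , e)
    }
    where open IsFilter (F₁.isFilter 0F x₁)

  τᵛ-isFilter : ∀ x → IsFilter (τᵛ x)
  τᵛ-isFilter (_ , x₂) = record
    { whole  = PolySet.U , whole , _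
    ; upward = λ U⊆W (V , V∈τ , V⊆U) → V , V∈τ , λ z → U⊆W (V⊆U z)
    ; inter  = λ (V , V∈τ , V⊆U) (V′ , V′∈τ , V′⊆U′) →
        V ∩ V′ , inter V∈τ V′∈τ , λ (e , (v , v′)) → V⊆U (e , v) , V′⊆U′ (e , v′)
    }
    where open IsFilter (F₂.isFilter 0F x₂)

  _⊗_ : NFrame 2 ℓ
  _⊗_ = record
    { Carrier  = F₁.Carrier × F₂.Carrier
    ; point    = F₁.point , F₂.point
    ; τ        = λ { 0F → τʰ ; 1F → τᵛ }
    ; isFilter = λ { 0F → τʰ-isFilter ; 1F → τᵛ-isFilter }
    }

------------------------------------------------------------------------
-- Derivational semantics

-- Subsets are considered up to ≐, whence `resp`. The empty set is open as
-- the union of the empty family. Under excluded middle for all universes,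
-- every subfamily of opens can be indexed by a type in Set ℓ, so `union`
-- covers arbitrary unions.
record TopSpace (ℓ : Level) : Set (suc (suc ℓ)) where
  field
    Carrier : Set ℓ
    point   : Carrier
    Open    : Family Carrier
    resp    : ∀ {U V} → U ≐ V → U ∈ Open → V ∈ Open
    whole   : PolySet.U ∈ Open
    inter   : ∀ {U V} → U ∈ Open → V ∈ Open → (U ∩ V) ∈ Open
    union   : ∀ (I : Set ℓ) U → (∀ i → U i ∈ Open) → ⋃ I U ∈ Open

module _ (𝔛 : TopSpace ℓ) where
  open TopSpace 𝔛

  τd : Carrier → Family Carrier
  τd x U = ∃[ U′ ] U′ ∈ Open × x ∈ U′ × (U′ ∖ ｛ x ｝) ⊆ U

  τd-isFilter : ∀ x → IsFilter (τd x)
  τd-isFilter x = record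
    { whole  = PolySet.U , whole , _ , _
    ; upward = λ U⊆V (U′ , o , x∈ , U′⊆U) → U′ , o , x∈ , λ z → U⊆V (U′⊆U z)
    ; inter  = λ (U′ , o , x∈ , U′⊆U) (V′ , o′ , x∈′ , V′⊆V) →
        U′ ∩ V′ , inter o o′ , (x∈ , x∈′) ,
        λ ((u , v) , ≢x) → U′⊆U (u , ≢x) , V′⊆V (v , ≢x)
    }

  𝒩d : NFrame 1 ℓ
  𝒩d = record
    { Carrier  = Carrier
    ; point    = point
    ; τ        = λ _ → τd
    ; isFilter = λ _ → τd-isFilter
    }

_⊨d_ : TopSpace ℓ → Pred (Formula 1) a → Set (a ⊔ suc ℓ)
𝔛 ⊨d L = ∀ {A} → A ∈ L → Valid (𝒩d 𝔛) A

-- L₁ ×d[ ℓ ] L₂: the spaces range over those with carrier in Set ℓ.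
_×d[_]_ : Pred (Formula 1) a → (ℓ : Level) → Pred (Formula 1) b →
          Pred (Formula 2) (a ⊔ b ⊔ suc (suc ℓ))
(L₁ ×d[ ℓ ] L₂) A = (𝔛₁ 𝔛₂ : TopSpace ℓ) → 𝔛₁ ⊨d L₁ → 𝔛₂ ⊨d L₂ →
                    Valid (𝒩d 𝔛₁ ⊗ 𝒩d 𝔛₂) A

{-# OPTIONS --safe #-}
module Submission where

-- Let w₀ be a maximal consistent set of L = ⟨L₁ , L₂⟩ omitting a non-theorem. Points of 𝔛ᵢ are finite
-- sequences of timed moves, each towards a maximal consistent set, and a basic neighbourhood of x
-- consists of the prolongations of x by moves made after a given time. A pair (x , y) is mapped to
-- the maximal consistent set reached from w₀ by executing the moves of x and y in order of time, as
-- moves of R₁ and R₂. Near x, with y fixed, all new moves come last and are R₁-moves, so by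
-- transitivity this map is a bounded morphism. Without seriality a move of x may be unavailable,
-- and whether it is must not depend on y: Δ makes closed □₂-free formulas invariant under R₂, and
-- these formulas alone decide which moves of x are available. In D4 * D4 every closed formula is
-- provable or refutable, so Δ is redundant there.

open import Defs
open import Axiom.ExcludedMiddle using (ExcludedMiddle)
open import Data.Bool using (Bool; true; false; not; _∨_; if_then_else_)
open import Data.Fin using (Fin; opposite)
open import Data.Fin.Patterns using (0F; 1F)
open import Data.List using (List; []; _∷_; _++_; allFin; cartesianProductWith)
open import Data.List.Membership.Propositional renaming (_∈_ to _∈ₗ_) using ()
open import Data.List.Membership.Propositional.Properties
  using (∈-++⁺ˡ; ∈-++⁺ʳ; ∈-allFin; ∈-cartesianProductWith⁺)
open import Data.List.Relation.Unary.Any using (here; there)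
open import Data.Nat as ℕ using (ℕ; zero; suc; _≤_; _<ᵇ_)
  renaming (_⊔_ to _⊔ₙ_)
import Data.Nat.Properties as ℕ
open import Data.Product using (_×_; _,_; ∃-syntax; proj₁; proj₂)
open import Data.Sum using (_⊎_; inj₁; inj₂)
open import Function using (id; _∘_)
open import Function.Bundles using (_⇔_; mk⇔; Equivalence)
open import Level using (Level; 0ℓ; Lift; lift; lower) renaming (suc to lsuc)
open import Relation.Binary.PropositionalEquality
  using (_≡_; _≢_; refl; sym; trans; cong; subst)
open import Relation.Nullary using (¬_; yes; no; does; proof; contradiction)
open import Relation.Nullary.Decidable
  using (True; toWitness; fromWitness; does-⇔; _→-dec_; dec-true; dec-false; decidable-stable)
open import Relation.Nullary.Reflects using (Reflects; ofⁿ; invert; _→-reflects_)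
open import Relation.Unary using (Pred; _∈_; _∉_; _⊆_; _≐_; _∩_; _∪_; _∖_; ｛_｝; _⟨×⟩_)
import Relation.Unary.Polymorphic as PolySet

private
  variable
    ℓ ℓ₁ : Level
    n : ℕ
    A : Formula n

-- Propositional tautologies and closed formulas

module _ (A : Formula n) where
  taut-refl : Tautology (A ⇒ A)
  taut-refl v with eval v A
  ... | true  = refl
  ... | false = refl

  taut-dne : Tautology (¬ᶠ ¬ᶠ A ⇒ A)
  taut-dne v with eval v A
  ... | true  = refl
  ... | false = refl

module _ (A B : Formula n) where
  taut-const : Tautology (B ⇒ A ⇒ B)
  taut-const v with eval v A | eval v B
  ... | true  | true  = refl
  ... | true  | false = refl
  ... | false | true  = refl
  ... | false | false = refl

  taut-efq : Tautology (¬ᶠ A ⇒ A ⇒ B)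
  taut-efq v with eval v A | eval v B
  ... | true  | true  = refl
  ... | true  | false = refl
  ... | false | true  = refl
  ... | false | false = refl

  taut-¬⇒ : Tautology (A ⇒ ¬ᶠ B ⇒ ¬ᶠ (A ⇒ B))
  taut-¬⇒ v with eval v A | eval v B
  ... | true  | true  = refl
  ... | true  | false = refl
  ... | false | true  = refl
  ... | false | false = refl

  taut-mt : Tautology ((A ⇒ B) ⇒ ¬ᶠ B ⇒ ¬ᶠ A)
  taut-mt v with eval v A | eval v B
  ... | true  | true  = refl
  ... | true  | false = refl
  ... | false | true  = refl
  ... | false | false = refl

module _ (A B C : Formula n) where
  taut-S : Tautology ((A ⇒ B ⇒ C) ⇒ (A ⇒ B) ⇒ A ⇒ C)
  taut-S v with eval v A | eval v B | eval v C
  ... | true  | true  | true  = refl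
  ... | true  | true  | false = refl
  ... | true  | false | true  = refl
  ... | true  | false | false = refl
  ... | false | true  | true  = refl
  ... | false | true  | false = refl
  ... | false | false | true  = refl
  ... | false | false | false = refl

infixr 6 _∧ᶠ_
_∧ᶠ_ : Formula n → Formula n → Formula n
A ∧ᶠ B = ¬ᶠ (A ⇒ ¬ᶠ B)

taut-mp-∧ : ∀ (A B C D : Formula n) → Tautology ((A ⇒ C ⇒ D) ⇒ (B ⇒ C) ⇒ (A ∧ᶠ B) ⇒ D)
taut-mp-∧ A B C D v with eval v A | eval v B | eval v C | eval v D
... | true  | true  | true  | true  = refl
... | true  | true  | true  | false = refl
... | true  | true  | false | true  = refl
... | true  | true  | false | false = refl
... | true  | false | true  | true  = refl
... | true  | false | true  | false = refl
... | true  | false | false | true  = refl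
... | true  | false | false | false = refl
... | false | true  | true  | true  = refl
... | false | true  | true  | false = refl
... | false | true  | false | true  = refl
... | false | true  | false | false = refl
... | false | false | true  | true  = refl
... | false | false | true  | false = refl
... | false | false | false | true  = refl
... | false | false | false | false = refl

module _ {L : Pred (Formula n) ℓ} (isL : IsLogic L) where
  private
    module ⊢ = IsLogic isL

  dist-of : ∀ i A B → (□ i (A ⇒ B) ⇒ □ i A ⇒ □ i B) ∈ L
  dist-of i A B = ⊢.sub (λ { zero → A ; (suc _) → B }) (⊢.dist i)

  -- Under seriality boxes do not change the status of a closed formula: necessitation boxes what is
  -- provable, and the box of a refuted formula implies `□ i ⊥`.
  decides-closed : (∀ i → ¬ᶠ (□ i ⊥) ∈ L) → ∀ A → Closed A → A ∈ L ⊎ ¬ᶠ A ∈ L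
  decides-closed d ⊥ _ = inj₂ (⊢.taut (taut-refl ⊥))
  decides-closed d (A ⇒ B) (cA , cB)
    with decides-closed d A cA | decides-closed d B cB
  ... | _       | inj₁ b  = inj₁ (⊢.mp (⊢.taut (taut-const A B)) b)
  ... | inj₁ a  | inj₂ ¬b = inj₂ (⊢.mp (⊢.mp (⊢.taut (taut-¬⇒ A B)) a) ¬b)
  ... | inj₂ ¬a | inj₂ _  = inj₁ (⊢.mp (⊢.taut (taut-efq A B)) ¬a)
  decides-closed d (□ i A) cA with decides-closed d A cA
  ... | inj₁ a  = inj₁ (⊢.nec i a)
  ... | inj₂ ¬a = inj₂ (⊢.mp (⊢.mp (⊢.taut (taut-mt (□ i A) (□ i ⊥)))
      (⊢.mp (dist-of i A ⊥) (⊢.nec i ¬a))) (d i))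

  closed⇒□ : (∀ i → ¬ᶠ (□ i ⊥) ∈ L) → ∀ i A → Closed A → (A ⇒ □ i A) ∈ L
  closed⇒□ d i A cA with decides-closed d A cA
  ... | inj₁ a  = ⊢.mp (⊢.taut (taut-const A (□ i A))) (⊢.nec i a)
  ... | inj₂ ¬a = ⊢.mp (⊢.taut (taut-efq A (□ i A))) ¬a

-- Exhausting the formulas by finite lists

increasing : ∀ {a} {X : Set a} (P : ℕ → Pred X ℓ) → (∀ k → P k ⊆ P (suc k)) →
             ∀ {k l} → k ≤ l → P k ⊆ P l
increasing P P⊆ k≤l = go (ℕ.≤⇒≤′ k≤l)
  where
  go : ∀ {k l} → k ℕ.≤′ l → P k ⊆ P l
  go ℕ.≤′-refl       = id
  go (ℕ.≤′-step k≤l) = P⊆ _ ∘ go k≤l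

-- Finite cumulative lists stand in for an enumeration: saturation only asks that every formula
-- occur in some list, and repetitions do no harm.
formulas : ℕ → List (Formula n)
formulas zero    = []
formulas (suc k) = formulas k ++ ⊥ ∷ var k ∷
  cartesianProductWith _⇒_ (formulas k) (formulas k) ++ cartesianProductWith □ (allFin _) (formulas k)

formulas-mono : ∀ {k l} → k ≤ l → {A : Formula n} → A ∈ₗ formulas k → A ∈ₗ formulas l
formulas-mono k≤l = increasing (λ k A → A ∈ₗ formulas k) (λ _ → ∈-++⁺ˡ) k≤l

formulas-exhaust : (A : Formula n) → ∃[ k ] A ∈ₗ formulas k
formulas-exhaust (var p) = suc p , ∈-++⁺ʳ (formulas p) (there (here refl))
formulas-exhaust ⊥       = 1 , here refl
formulas-exhaust (A ⇒ B) with formulas-exhaust A | formulas-exhaust B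
... | k , A∈ | l , B∈ = suc (k ⊔ₙ l) , ∈-++⁺ʳ (formulas (k ⊔ₙ l)) (there (there (∈-++⁺ˡ
  (∈-cartesianProductWith⁺ _⇒_ (formulas-mono (ℕ.m≤m⊔n k l) A∈) (formulas-mono (ℕ.m≤n⊔m k l) B∈)))))
formulas-exhaust (□ i A) with formulas-exhaust A
... | k , A∈ = suc k , ∈-++⁺ʳ (formulas k) (there (there
  (∈-++⁺ʳ (cartesianProductWith _⇒_ (formulas k) (formulas k))
    (∈-cartesianProductWith⁺ □ (∈-allFin i) A∈))))

-- Soundness

module _ (em : ∀ {a} → ExcludedMiddle a) where

  -- Semantic values live one universe above the sets used in valuations; under
  -- excluded middle a proposition can be moved down.
  module _ (ℓ : Level) where
    Resize : Set ℓ₁ → Set ℓ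
    Resize P = Lift ℓ (True (em {P = P}))

    resize⇔ : {P : Set ℓ₁} → P ⇔ Resize P
    resize⇔ = mk⇔ (λ p → lift (fromWitness p)) (λ r → toWitness (lower r))

  module _ (F : NFrame n ℓ) where
    open NFrame F using (Carrier; τ; isFilter)

    module _ (V : Valuation F) (x : Carrier) where
      private
        truth : Formula n → Bool
        truth A = does (em {P = ⟦ F ⟧ A V x})

      eval-reflects : ∀ A → Reflects (⟦ F ⟧ A V x) (eval truth A)
      eval-reflects (var p) = proof em
      eval-reflects ⊥       = ofⁿ λ ()
      eval-reflects (A ⇒ B) = eval-reflects A →-reflects eval-reflects B
      eval-reflects (□ i A) = proof em

      taut-valid : Tautology A → x ∈ ⟦ F ⟧ A V
      taut-valid {A} t = invert (subst (Reflects _) (t truth) (eval-reflects A))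

    module _ (σ : ℕ → Formula n) (V : Valuation F) where
      private
        V[σ] : Valuation F
        V[σ] p x = Resize ℓ (⟦ F ⟧ (σ p) V x)

      sub-sound : ∀ A x → x ∈ ⟦ F ⟧ (A [ σ ]) V ⇔ x ∈ ⟦ F ⟧ A V[σ]
      sub-sound (var p) x = mk⇔ (λ a → lift (to a)) (λ a → from (lower a))
        where open Equivalence (resize⇔ ℓ)
      sub-sound ⊥ x = mk⇔ id id
      sub-sound (A ⇒ B) x = mk⇔ (λ f a → B′.to (f (A′.from a))) (λ f a → B′.from (f (A′.to a)))
        where module A′ = Equivalence (sub-sound A x)
              module B′ = Equivalence (sub-sound B x)
      sub-sound (□ i A) x = mk⇔
        (λ (U , U∈ , U⊆) → U , U∈ , λ {y} u → Equivalence.to (sub-sound A y) (U⊆ u))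
        (λ (U , U∈ , U⊆) → U , U∈ , λ {y} u → Equivalence.from (sub-sound A y) (U⊆ u))

    Valid-isLogic : IsLogic (Valid F)
    Valid-isLogic = record
      { taut = λ t V x → taut-valid V x t
      ; dist = λ i V x (U , U∈ , U⊆) (W , W∈ , W⊆) →
          U ∩ W , IsFilter.inter (isFilter i x) U∈ W∈ , λ (u , w) → U⊆ u (W⊆ w)
      ; sub  = λ {A} σ a V x → Equivalence.from (sub-sound σ V A x) (a _ x)
      ; mp   = λ f a V x → f V x (a V x)
      ; nec  = λ i a V x → _ , IsFilter.whole (isFilter i x) , λ _ → a V _
      }

  module _ (F₁ F₂ : NFrame 1 ℓ) (V : Valuation (F₁ ⊗ F₂)) where
    -- Horizontal neighbourhoods never leave a row, so each row with the restricted valuation is a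
    -- copy of `F₁`.
    relabel-horizontal : ∀ A x y →
      (x , y) ∈ ⟦ F₁ ⊗ F₂ ⟧ (relabel (λ _ → 0F) A) V ⇔ x ∈ ⟦ F₁ ⟧ A (λ p x′ → V p (x′ , y))
    relabel-horizontal (var p) x y = mk⇔ id id
    relabel-horizontal ⊥       x y = mk⇔ id id
    relabel-horizontal (A ⇒ B) x y =
      mk⇔ (λ f a → B′.to (f (A′.from a))) (λ f a → B′.from (f (A′.to a)))
      where module A′ = Equivalence (relabel-horizontal A x y)
            module B′ = Equivalence (relabel-horizontal B x y)
    relabel-horizontal (□ 0F A) x y = mk⇔
      (λ (U , (W , W∈ , W⊆) , U⊆) → W , W∈ , λ {x′} w →
        Equivalence.to (relabel-horizontal A x′ y) (U⊆ (W⊆ (w , refl))))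
      (λ (W , W∈ , W⊆) → (W ⟨×⟩ ｛ y ｝) , (W , W∈ , id) ,
        λ { {x′ , _} (w , refl) → Equivalence.from (relabel-horizontal A x′ y) (W⊆ w) })

    relabel-vertical : ∀ A x y →
      (x , y) ∈ ⟦ F₁ ⊗ F₂ ⟧ (relabel (λ _ → 1F) A) V ⇔ y ∈ ⟦ F₂ ⟧ A (λ p y′ → V p (x , y′))
    relabel-vertical (var p) x y = mk⇔ id id
    relabel-vertical ⊥       x y = mk⇔ id id
    relabel-vertical (A ⇒ B) x y =
      mk⇔ (λ f a → B′.to (f (A′.from a))) (λ f a → B′.from (f (A′.to a)))
      where module A′ = Equivalence (relabel-vertical A x y)
            module B′ = Equivalence (relabel-vertical B x y)
    relabel-vertical (□ 0F A) x y = mk⇔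
      (λ (U , (W , W∈ , W⊆) , U⊆) → W , W∈ , λ {y′} w →
        Equivalence.to (relabel-vertical A x y′) (U⊆ (W⊆ (refl , w))))
      (λ (W , W∈ , W⊆) → (｛ x ｝ ⟨×⟩ W) , (W , W∈ , id) ,
        λ { {_ , y′} (refl , w) → Equivalence.from (relabel-vertical A x y′) (W⊆ w) })

    -- All rows are copies of one frame, and a closed formula does not see the valuation. Both `y`
    -- and `y′` vary in the induction because an implication needs the reverse direction for its
    -- antecedent.
    closed-independent₂ : ∀ A → Closed A → BoxFree 1F A → ∀ x y y′ →
      (x , y) ∈ ⟦ F₁ ⊗ F₂ ⟧ A V → (x , y′) ∈ ⟦ F₁ ⊗ F₂ ⟧ A V
    closed-independent₂ ⊥ _ _ x y y′ ()
    closed-independent₂ (A ⇒ B) (cA , cB) (bA , bB) x y y′ f a =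
      closed-independent₂ B cB bB x y y′ (f (closed-independent₂ A cA bA x y′ y a))
    closed-independent₂ (□ 0F A) c (_ , b) x y y′ (U , (W , W∈ , W⊆) , U⊆) =
      (W ⟨×⟩ ｛ y′ ｝) , (W , W∈ , id) ,
      λ { {x′ , _} (w , refl) → closed-independent₂ A c b x′ y y′ (U⊆ (W⊆ (w , refl))) }
    closed-independent₂ (□ 1F A) c (1≢1 , _) = contradiction refl 1≢1

    closed-independent₁ : ∀ A → Closed A → BoxFree 0F A → ∀ x x′ y →
      (x , y) ∈ ⟦ F₁ ⊗ F₂ ⟧ A V → (x′ , y) ∈ ⟦ F₁ ⊗ F₂ ⟧ A V
    closed-independent₁ ⊥ _ _ x x′ y ()
    closed-independent₁ (A ⇒ B) (cA , cB) (bA , bB) x x′ y f a =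
      closed-independent₁ B cB bB x x′ y (f (closed-independent₁ A cA bA x′ x y a))
    closed-independent₁ (□ 1F A) c (_ , b) x x′ y (U , (W , W∈ , W⊆) , U⊆) =
      (｛ x′ ｝ ⟨×⟩ W) , (W , W∈ , id) ,
      λ { {_ , y′} (refl , w) → closed-independent₁ A c b x x′ y′ (U⊆ (W⊆ (refl , w))) }
    closed-independent₁ (□ 0F A) c (0≢0 , _) = contradiction refl 0≢0

  ⟨,⟩-sound : ∀ (L₁ L₂ : Pred (Formula 1) 0ℓ) ℓ → ⟨ L₁ , L₂ ⟩ ⊆ (L₁ ×d[ ℓ ] L₂)
  ⟨,⟩-sound L₁ L₂ ℓ a 𝔛₁ 𝔛₂ ⊨L₁ ⊨L₂ =
    minimal (λ { (inj₁ b) → minimal (λ { (inj₁ c) → minimal inner c ; (inj₂ c) → vertical c }) b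
               ; (inj₂ d) → Δ-sound d }) a
    where
    F₁ = 𝒩d 𝔛₁
    F₂ = 𝒩d 𝔛₂
    minimal : ∀ {Γ : Pred (Formula 2) 0ℓ} → Γ ⊆ Valid (F₁ ⊗ F₂) → Least Γ ⊆ Valid (F₁ ⊗ F₂)
    minimal = Least-minimal (Valid-isLogic (F₁ ⊗ F₂))
    vertical : rename 1F L₂ ⊆ Valid (F₁ ⊗ F₂)
    vertical (A , A∈ , refl) V (x , y) =
      Equivalence.from (relabel-vertical F₁ F₂ V A x y) (⊨L₂ A∈ _ y)
    inner : (Kₙ 2 ∪ rename 0F L₁) ⊆ Valid (F₁ ⊗ F₂)
    inner (inj₁ c) = minimal (λ ()) c
    inner (inj₂ (A , A∈ , refl)) V (x , y) =
      Equivalence.from (relabel-horizontal F₁ F₂ V A x y) (⊨L₁ A∈ _ x)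
    Δ-sound : Δ ⊆ Valid (F₁ ⊗ F₂)
    Δ-sound (inj₁ (B , c , f , refl)) V (x , y) b =
      -- Truth of `B` is constant along the column, so the whole column is a witness.
      (｛ x ｝ ⟨×⟩ PolySet.U) , (PolySet.U , IsFilter.whole (NFrame.isFilter F₂ 0F y) , id) ,
      λ { {_ , y′} (refl , _) → closed-independent₂ F₁ F₂ V B c f x y y′ b }
    Δ-sound (inj₂ (B , c , f , refl)) V (x , y) b =
      (PolySet.U ⟨×⟩ ｛ y ｝) , (PolySet.U , IsFilter.whole (NFrame.isFilter F₁ 0F x) , id) ,
      λ { {x′ , _} (_ , refl) → closed-independent₁ F₁ F₂ V B c f x x′ y b }

  -- Maximal consistent sets

  module Lindenbaum {n : ℕ} (L : Pred (Formula n) 0ℓ) (isL : IsLogic L) where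
    private
      module ⊢ = IsLogic isL

    -- A maximal consistent set, given by its characteristic function. Boolean values keep `World`
    -- in the lowest universe, so that spaces built from worlds exist at every level `ℓ`.
    record World : Set where
      field
        val   : Formula n → Bool
        val-⊥ : val ⊥ ≡ false
        val-⇒ : ∀ A B → val (A ⇒ B) ≡ not (val A) ∨ val B
        val-L : ∀ {A} → A ∈ L → val A ≡ true
    open World

    infix 4 _∋_
    _∋_ : World → Formula n → Set
    w ∋ A = val w A ≡ true

    ∋-mp : ∀ w {A B} → w ∋ A ⇒ B → w ∋ A → w ∋ B
    ∋-mp w {A} {B} ab a = trans (sym (trans (val-⇒ w A B) (cong (λ t → not t ∨ val w B) a))) ab

    ∌⊥ : ∀ w → ¬ (w ∋ ⊥)
    ∌⊥ w w∋⊥ with trans (sym w∋⊥) (val-⊥ w)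
    ... | ()

    ∋-⇒ : ∀ w A B → (w ∋ A → w ∋ B) → w ∋ A ⇒ B
    ∋-⇒ w A B f with val w A | val w B | val-⇒ w A B | f
    ... | true  | true  | e | _ = e
    ... | true  | false | e | g = trans e (g refl)
    ... | false | _     | e | _ = e

    ∋-dec : ∀ w A → w ∋ A ⊎ w ∋ ¬ᶠ A
    ∋-dec w A with val w A in e
    ... | true  = inj₁ refl
    ... | false = inj₂ (trans (val-⇒ w A ⊥) (cong (λ t → not t ∨ val w ⊥) e))

    -- Closure under necessitation or substitution is not demanded, since theories carry local
    -- assumptions.
    record IsTheory (T : Pred (Formula n) 0ℓ) : Set where
      field
        ⊇L     : L ⊆ T
        closed : ∀ {A B} → A ⇒ B ∈ T → A ∈ T → B ∈ T
    open IsTheory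

    Consistent : Pred (Formula n) 0ℓ → Set
    Consistent T = ⊥ ∉ T

    L-theory : IsTheory L
    L-theory = record { ⊇L = id ; closed = ⊢.mp }

    infixl 6 _⊕_
    -- For a theory `T` this is the theory generated by `T` and `A`: the deduction theorem is taken
    -- as the definition.
    _⊕_ : Pred (Formula n) 0ℓ → Formula n → Pred (Formula n) 0ℓ
    T ⊕ A = λ B → A ⇒ B ∈ T

    module _ {T : Pred (Formula n) 0ℓ} (isT : IsTheory T) (A : Formula n) where
      ⊆⊕ : T ⊆ T ⊕ A
      ⊆⊕ {B} b = closed isT (⊇L isT (⊢.taut (taut-const A B))) b

      ∈⊕ : A ∈ T ⊕ A
      ∈⊕ = ⊇L isT (⊢.taut (taut-refl A))

      ⊕-theory : IsTheory (T ⊕ A)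
      ⊕-theory = record
        { ⊇L     = λ a → ⊆⊕ (⊇L isT a)
        ; closed = λ {B} {C} f b → closed isT (closed isT (⊇L isT (⊢.taut (taut-S A B C))) f) b
        }

      ¬-consistent⇒∈ : ¬ Consistent (T ⊕ ¬ᶠ A) → A ∈ T
      ¬-consistent⇒∈ c = closed isT (⊇L isT (⊢.taut (taut-dne A))) (decidable-stable em c)

    -- For a theory `T` this is `T ⊕ A` if that is consistent and `T` otherwise; the disjunction
    -- expresses the case distinction without deciding it.
    next : Pred (Formula n) 0ℓ → Formula n → Pred (Formula n) 0ℓ
    next T A B = B ∈ T ⊎ Consistent (T ⊕ A) × B ∈ T ⊕ A

    module _ {T : Pred (Formula n) 0ℓ} (isT : IsTheory T) where
      next-theory : ∀ A → IsTheory (next T A)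
      next-theory A = record { ⊇L = λ a → inj₁ (⊇L isT a) ; closed = elim }
        where
        elim : ∀ {B C} → B ⇒ C ∈ next T A → B ∈ next T A → C ∈ next T A
        elim (inj₁ f)       (inj₁ b)       = inj₁ (closed isT f b)
        elim (inj₁ f)       (inj₂ (c , b)) = inj₂ (c , closed (⊕-theory isT A) (⊆⊕ isT A f) b)
        elim (inj₂ (c , f)) (inj₁ b)       = inj₂ (c , closed (⊕-theory isT A) f (⊆⊕ isT A b))
        elim (inj₂ (c , f)) (inj₂ (_ , b)) = inj₂ (c , closed (⊕-theory isT A) f b)

      next-consistent : ∀ A → Consistent T → Consistent (next T A)
      next-consistent A c (inj₁ ⊥∈T)        = c ⊥∈T
      next-consistent A _ (inj₂ (c , ⊥∈T⊕A)) = c ⊥∈T⊕A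

      next-decides : ∀ A → A ∈ next T A ⊎ ¬ᶠ A ∈ next T A
      next-decides A with em {P = ⊥ ∈ T ⊕ A}
      -- `⊥ ∈ T ⊕ A` unfolds to `¬ᶠ A ∈ T`.
      ... | yes ¬a = inj₂ (inj₁ ¬a)
      ... | no  c  = inj₁ (inj₂ (c , ∈⊕ isT A))

    saturate : Pred (Formula n) 0ℓ → List (Formula n) → Pred (Formula n) 0ℓ
    saturate T []       = T
    saturate T (A ∷ As) = saturate (next T A) As

    ⊆saturate : ∀ {T} As → T ⊆ saturate T As
    ⊆saturate []       = id
    ⊆saturate (A ∷ As) = ⊆saturate As ∘ inj₁

    saturate-theory : ∀ {T} → IsTheory T → ∀ As → IsTheory (saturate T As)
    saturate-theory isT []       = isT
    saturate-theory isT (A ∷ As) = saturate-theory (next-theory isT A) As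

    saturate-consistent : ∀ {T} → IsTheory T → Consistent T → ∀ As → Consistent (saturate T As)
    saturate-consistent isT c []       = c
    saturate-consistent isT c (A ∷ As) =
      saturate-consistent (next-theory isT A) (next-consistent isT A c) As

    saturate-decides : ∀ {T} → IsTheory T → ∀ {As A} → A ∈ₗ As →
                       A ∈ saturate T As ⊎ ¬ᶠ A ∈ saturate T As
    saturate-decides isT {A ∷ As} (here refl) with next-decides isT A
    ... | inj₁ a  = inj₁ (⊆saturate As a)
    ... | inj₂ ¬a = inj₂ (⊆saturate As ¬a)
    saturate-decides isT {A ∷ As} (there B∈As) = saturate-decides (next-theory isT A) B∈As

    module _ {T : Pred (Formula n) 0ℓ} (isT : IsTheory T) (con : Consistent T) where
      stage : ℕ → Pred (Formula n) 0ℓ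
      stage zero    = T
      stage (suc k) = saturate (stage k) (formulas k)

      stage-theory : ∀ k → IsTheory (stage k)
      stage-theory zero    = isT
      stage-theory (suc k) = saturate-theory (stage-theory k) (formulas k)

      stage-consistent : ∀ k → Consistent (stage k)
      stage-consistent zero    = con
      stage-consistent (suc k) = saturate-consistent (stage-theory k) (stage-consistent k) (formulas k)

      limit : Pred (Formula n) 0ℓ
      limit A = ∃[ k ] A ∈ stage k

      limit-theory : IsTheory limit
      limit-theory = record
        { ⊇L     = λ a → 0 , ⊇L isT a
        ; closed = λ (k , f) (l , b) → k ⊔ₙ l , closed (stage-theory (k ⊔ₙ l))
            (increasing stage stage-⊆ (ℕ.m≤m⊔n k l) f) (increasing stage stage-⊆ (ℕ.m≤n⊔m k l) b)
        }
        where
        stage-⊆ : ∀ k → stage k ⊆ stage (suc k)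
        stage-⊆ k = ⊆saturate (formulas k)

      limit-complete : ∀ A → A ∈ limit ⊎ ¬ᶠ A ∈ limit
      limit-complete A with formulas-exhaust A
      ... | k , A∈ with saturate-decides (stage-theory k) A∈
      ...   | inj₁ a  = inj₁ (suc k , a)
      ...   | inj₂ ¬a = inj₂ (suc k , ¬a)

      limit-⇒ : ∀ A B → (A ⇒ B ∈ limit) ⇔ (A ∈ limit → B ∈ limit)
      limit-⇒ A B = mk⇔ (closed limit-theory) from
        where
        from : (A ∈ limit → B ∈ limit) → A ⇒ B ∈ limit
        from f with limit-complete A
        ... | inj₁ a  = ⊆⊕ limit-theory A (f a)
        ... | inj₂ ¬a = closed limit-theory (⊇L limit-theory (⊢.taut (taut-efq A B))) ¬a

      lindenbaum : World
      lindenbaum = record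
        { val   = λ A → does (em {P = A ∈ limit})
        ; val-⊥ = dec-false em λ (k , ⊥∈) → stage-consistent k ⊥∈
        ; val-⇒ = λ A B → does-⇔ (limit-⇒ A B) em (em →-dec em)
        ; val-L = λ a → dec-true em (⊇L limit-theory a)
        }

      ⊆lindenbaum : ∀ {A} → A ∈ T → lindenbaum ∋ A
      ⊆lindenbaum a = dec-true em (0 , a)

    module _ {T : Pred (Formula n) 0ℓ} (isT : IsTheory T) where
      -- A world extending `T ⊕ ¬ᶠ A` does it. This theory is consistent, since otherwise `¬ᶠ ¬ᶠ A`,
      -- and with it `A`, would lie in `T`.
      separate : ∀ {A} → A ∉ T → ∃[ w ] (∀ {B} → B ∈ T → w ∋ B) × ¬ (w ∋ A)
      separate {A} A∉T = w , (λ b → ⊆lindenbaum isT′ con (⊆⊕ isT (¬ᶠ A) b)) ,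
        λ a → ∌⊥ w (∋-mp w (⊆lindenbaum isT′ con (∈⊕ isT (¬ᶠ A))) a)
        where
        isT′ : IsTheory (T ⊕ ¬ᶠ A)
        isT′ = ⊕-theory isT (¬ᶠ A)
        con : Consistent (T ⊕ ¬ᶠ A)
        con ⊥∈ = A∉T (¬-consistent⇒∈ isT A λ c → c ⊥∈)
        w : World
        w = lindenbaum isT′ con

  -- Canonical moves

  module Canonical
    (L : Pred (Formula 2) 0ℓ) (isL : IsLogic L)
    (four : ∀ i A → □ i A ⇒ □ i (□ i A) ∈ L)
    (persist : ∀ i A → Closed A → BoxFree i A → A ⇒ □ i A ∈ L)
    where
    private
      module ⊢ = IsLogic isL
    open Lindenbaum L isL
    open World using (val-L)
    open IsTheory

    -- Formulas whose truth a move along `i` preserves. They are the closed formulas of the other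
    -- modality, so those of modality `i` alone form `Inv (opposite i)`.
    Inv : Fin 2 → Pred (Formula 2) 0ℓ
    Inv i A = Closed A × BoxFree i A

    i≢opposite : ∀ (i : Fin 2) → i ≢ opposite i
    i≢opposite 0F ()
    i≢opposite 1F ()

    Inv-□ : ∀ i {A} → A ∈ Inv (opposite i) → □ i A ∈ Inv (opposite i)
    Inv-□ i (c , b) = c , i≢opposite i , b

    Inv-∧ : ∀ {j A B} → A ∈ Inv j → B ∈ Inv j → A ∧ᶠ B ∈ Inv j
    Inv-∧ (cA , bA) (cB , bB) = ((cA , (cB , _)) , _) , ((bA , (bB , _)) , _)

    R : Fin 2 → World → World → Set
    R i w u = ∀ A → w ∋ □ i A → u ∋ A

    -- The shadow of R i on closed formulas of the i-th modality alone.
    Rᶜ : Fin 2 → World → World → Set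
    Rᶜ i w u = ∀ A → A ∈ Inv (opposite i) → w ∋ □ i A → u ∋ A

    _≲[_]_ : World → Fin 2 → World → Set
    w ≲[ j ] u = ∀ {A} → A ∈ Inv j → w ∋ A → u ∋ A

    ≲-trans : ∀ {j} w u v → w ≲[ j ] u → u ≲[ j ] v → w ≲[ j ] v
    ≲-trans _ _ _ p q a = q a ∘ p a

    -- `Inv j` is closed under negation and worlds are complete, so inclusion already gives
    -- agreement.
    ≲-sym : ∀ {j} w u → w ≲[ j ] u → u ≲[ j ] w
    ≲-sym w u w≲u {A} (c , b) u∋A with ∋-dec w A
    ... | inj₁ w∋A  = w∋A
    ... | inj₂ w∋¬A = contradiction (∋-mp u (w≲u ((c , _) , (b , _)) w∋¬A) u∋A) (∌⊥ u)

    R-trans : ∀ i w u v → R i w u → R i u v → R i w v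
    R-trans i w u v p q A a = q A (p (□ i A) (∋-mp w (val-L w (four i A)) a))

    -- Here `Δ` enters, through `persist`. With `≲-sym`, an `R i` step leaves the closed formulas of
    -- the other modality unchanged.
    R-≲ : ∀ i w u → R i w u → w ≲[ i ] u
    R-≲ i w u p {A} (c , b) a = p A (∋-mp w (val-L w (persist i A c b)) a)

    Rᶜ-≲ : ∀ i w w′ u → w ≲[ opposite i ] w′ → Rᶜ i w′ u → Rᶜ i w u
    Rᶜ-≲ i _ _ _ w≲w′ p A A∈ a = p A A∈ (w≲w′ (Inv-□ i A∈) a)

    □-mp : ∀ i w {A B} → w ∋ □ i (A ⇒ B) → w ∋ □ i A → w ∋ □ i B
    □-mp i w {A} {B} f a = ∋-mp w (∋-mp w (val-L w (dist-of isL i A B)) f) a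

    □⁻-theory : ∀ i w → IsTheory (λ B → w ∋ □ i B)
    □⁻-theory i w = record { ⊇L = λ a → val-L w (⊢.nec i a) ; closed = □-mp i w }

    -- The formulas boxed in `w` form a theory omitting `A`, which `separate` extends to a world.
    □-witness : ∀ i w {A} → ¬ (w ∋ □ i A) → ∃[ u ] R i w u × ¬ (u ∋ A)
    □-witness i w ¬□A with separate (□⁻-theory i w) ¬□A
    ... | u , p , u∌A = u , (λ _ → p) , u∌A

    -- A world realising Fibre i w u is an R i-successor of w that agrees with u on
    -- closed formulas of the i-th modality.
    Fibre : Fin 2 → World → World → Pred (Formula 2) 0ℓ
    Fibre i w u B = ∃[ D ] D ∈ Inv (opposite i) × u ∋ D × w ∋ □ i (D ⇒ B)

    Fibre-theory : ∀ i w u → IsTheory (Fibre i w u)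
    Fibre-theory i w u = record
      -- `⊥ ⇒ ⊥` serves as an empty hypothesis: it is closed, free of both boxes and true in `u`.
      { ⊇L     = λ {B} b → (⊥ ⇒ ⊥) , _ , ∋-⇒ u ⊥ ⊥ id ,
          val-L w (⊢.nec i (⊢.mp (⊢.taut (taut-const (⊥ ⇒ ⊥) B)) b))
      -- Two hypotheses from `u` are merged into their conjunction, again a closed formula of
      -- modality `i`, so that modus ponens can be carried out under the box.
      ; closed = λ {B} {C} (D , D∈ , u∋D , f) (E , E∈ , u∋E , b) →
          (D ∧ᶠ E) , Inv-∧ D∈ E∈ ,
          ∋-⇒ u (D ⇒ ¬ᶠ E) ⊥ (λ g → ∋-mp u (∋-mp u g u∋D) u∋E) ,
          □-mp i w (□-mp i w (val-L w (⊢.nec i (⊢.taut (taut-mp-∧ D E B C)))) f) b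
      }

    -- If `⊥` were in the fibre, `□ i (¬ᶠ D)` would lie in `w` for some closed `D` true in `u`, and
    -- `Rᶜ` applied to `¬ᶠ D` would refute `D` there.
    Fibre-consistent : ∀ i w u → Rᶜ i w u → Consistent (Fibre i w u)
    Fibre-consistent i w u p (D , (c , b) , u∋D , w∋) = ∌⊥ u (∋-mp u (p _ ((c , _) , (b , _)) w∋) u∋D)

    module _ (i : Fin 2) (w u : World) (p : Rᶜ i w u) where
      private
        v : World
        v = lindenbaum (Fibre-theory i w u) (Fibre-consistent i w u p)
        Fibre⊆v : ∀ {A} → A ∈ Fibre i w u → v ∋ A
        Fibre⊆v = ⊆lindenbaum (Fibre-theory i w u) (Fibre-consistent i w u p)

      Fibre-realised : ∃[ v ] R i w v × u ≲[ opposite i ] v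
      Fibre-realised = v ,
        (λ A a → Fibre⊆v ((⊥ ⇒ ⊥) , _ , ∋-⇒ u ⊥ ⊥ id ,
          □-mp i w (val-L w (⊢.nec i (⊢.taut (taut-const (⊥ ⇒ ⊥) A)))) a)) ,
        (λ {A} A∈ a → Fibre⊆v (A , A∈ , a , val-L w (⊢.nec i (⊢.taut (taut-refl A)))))

    -- Moving along i towards u. Which moves are available may depend only on the
    -- coordinate that moves, hence only Rᶜ, and not R, is demanded of u; the value
    -- off Rᶜ is junk.
    step : Fin 2 → World → World → World
    step i w u with em {P = R i w u} | em {P = Rᶜ i w u}
    ... | yes _ | _     = u
    ... | no  _ | yes p = proj₁ (Fibre-realised i w u p)
    ... | no  _ | no  _ = w

    step-R≡ : ∀ i w u → R i w u → step i w u ≡ u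
    step-R≡ i w u p with em {P = R i w u} | em {P = Rᶜ i w u}
    ... | yes _  | _ = refl
    ... | no ¬p | _ = contradiction p ¬p

    step-R : ∀ i w u → Rᶜ i w u → R i w (step i w u)
    step-R i w u p with em {P = R i w u} | em {P = Rᶜ i w u}
    ... | yes r | _     = r
    ... | no _  | yes p = proj₁ (proj₂ (Fibre-realised i w u p))
    ... | no _  | no ¬p = contradiction p ¬p

    step-≲ : ∀ i w u → Rᶜ i w u → step i w u ≲[ opposite i ] u
    step-≲ i w u p with em {P = R i w u} | em {P = Rᶜ i w u}
    ... | yes r | _     = λ _ → id
    ... | no _  | yes p = let (v , _ , u≲v) = Fibre-realised i w u p in ≲-sym u v u≲v
    ... | no _  | no ¬p = contradiction p ¬p

    -- The space of move sequences

    module Moves (ℓ : Level) (w₀ : World) where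

      -- move x t u _ prolongs x by a move towards u made at time t.
      data Point (i : Fin 2) : Set ℓ
      last : ∀ {i} → Point i → World

      data Point i where
        root : Point i
        move : (x : Point i) → ℕ → (u : World) → Rᶜ i (last x) u → Point i

      last root           = w₀
      last (move _ _ u _) = u

      data _⊑[_]_ {i : Fin 2} (x : Point i) (k : ℕ) : Point i → Set ℓ where
        stay : x ⊑[ k ] x
        push : ∀ {y t u p} → x ⊑[ k ] y → k ≤ t → x ⊑[ k ] move y t u p

      size : ∀ {i} → Point i → ℕ
      size root           = 0
      size (move x _ _ _) = suc (size x)

      module _ {i : Fin 2} where
        ⊑-trans : ∀ {k} {x y z : Point i} → x ⊑[ k ] y → y ⊑[ k ] z → x ⊑[ k ] z
        ⊑-trans p stay       = p
        ⊑-trans p (push q l) = push (⊑-trans p q) l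

        ⊑-weaken : ∀ {k l} {x y : Point i} → k ≤ l → x ⊑[ l ] y → x ⊑[ k ] y
        ⊑-weaken k≤l stay         = stay
        ⊑-weaken k≤l (push p l≤t) = push (⊑-weaken k≤l p) (ℕ.≤-trans k≤l l≤t)

        ⊑-size : ∀ {k} {x y : Point i} → x ⊑[ k ] y → size x ≤ size y
        ⊑-size stay       = ℕ.≤-refl
        ⊑-size (push p _) = ℕ.m≤n⇒m≤1+n (⊑-size p)

        -- Proper prolongations are strictly longer, so cones at `y` avoid `x`. This makes
        -- transitivity valid although punctured neighbourhoods omit their own point.
        ⊏-⊑-≢ : ∀ {k} {x y z : Point i} → x ⊑[ k ] y → x ≢ y → y ⊑[ k ] z → x ≢ z
        ⊏-⊑-≢ stay x≢y q _ = x≢y refl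
        ⊏-⊑-≢ (push p _) x≢y q refl = ℕ.<-irrefl refl (ℕ.≤-trans (ℕ.s≤s (⊑-size p)) (⊑-size q))

        move-≢ : ∀ (x : Point i) t u (p : Rᶜ i (last x) u) → x ≢ move x t u p
        move-≢ x t u p x≡ = ℕ.<-irrefl (cong size x≡) ℕ.≤-refl

      moves : Fin 2 → TopSpace ℓ
      moves i = record
        { Carrier = Point i
        ; point   = root
        ; Open    = λ U → Lift (lsuc ℓ) (∀ {x} → x ∈ U → ∃[ k ] (x ⊑[ k ]_) ⊆ U)
        ; resp    = λ (U⊆V , V⊆U) (lift o) → lift λ v → let (k , b) = o (V⊆U v) in k , U⊆V ∘ b
        ; whole   = lift λ _ → 0 , _
        ; inter   = λ (lift o) (lift o′) → lift λ (u , v) →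
            let (k , b) = o u ; (l , b′) = o′ v in
            k ⊔ₙ l , λ e → b (⊑-weaken (ℕ.m≤m⊔n k l) e) , b′ (⊑-weaken (ℕ.m≤n⊔m k l) e)
        ; union   = λ I U o → lift λ (j , u) → let (k , b) = lower (o j) u in k , λ e → j , b e
        }

      -- A cone is open, with the same `k` at each of its points; with `∈τd-cone`, punctured cones
      -- form a base of `τd`.
      cone-∈τd : ∀ {i} k (x : Point i) {U} → ((x ⊑[ k ]_) ∖ ｛ x ｝) ⊆ U → U ∈ τd (moves i) x
      cone-∈τd k x ⊆U = (x ⊑[ k ]_) , lift (λ p → k , ⊑-trans p) , stay , ⊆U

      ∈τd-cone : ∀ {i} (x : Point i) {U} → U ∈ τd (moves i) x →
                 ∃[ k ] ((x ⊑[ k ]_) ∖ ｛ x ｝) ⊆ U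
      ∈τd-cone x (U′ , lift o , x∈U′ , ⊆U) = let (k , b) = o x∈U′ in k , λ (p , ≢x) → ⊆U (b p , ≢x)

      moves-K4 : ∀ i → moves i ⊨d K4
      moves-K4 i = Least-minimal (Valid-isLogic _) λ
        { (inj₁ a)    → Least-minimal (Valid-isLogic (𝒩d (moves i))) (λ ()) a
        ; (inj₂ refl) → λ V x (U , U∈ , U⊆) → let (k , b) = ∈τd-cone x U∈ in
            ((x ⊑[ k ]_) ∖ ｛ x ｝) , cone-∈τd k x id , λ {y} (p , x≢y) →
            (y ⊑[ k ]_) , cone-∈τd k y proj₁ , λ q →
            U⊆ (b (⊑-trans p q , ⊏-⊑-≢ p x≢y q))
        }

      -- Seriality gives `last x` a successor, and a move towards it can be made at any time, so no
      -- punctured cone is empty.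
      moves-D4 : ∀ i → ¬ᶠ (□ i ⊥) ∈ L → moves i ⊨d D4
      moves-D4 i d = Least-minimal (Valid-isLogic _) λ
        { (inj₁ a)    → moves-K4 i a
        ; (inj₂ refl) → λ V x (U , U∈ , U⊆) →
            let (k , b)     = ∈τd-cone x U∈
                (u , r , _) = □-witness i (last x) λ a →
                  ∌⊥ (last x) (∋-mp (last x) (val-L (last x) d) a)
            in U⊆ (b (push stay (ℕ.≤-refl {k}) , move-≢ x k u (λ A _ → r A)))
        }

      -- Rows and columns as bounded morphisms

      module Slice
        (i : Fin 2) (g : Point i → World) (b : ℕ)
        (g-≲ : ∀ x → g x ≲[ opposite i ] last x)
        (g-move : ∀ x t u p → b ≤ t → g (move x t u p) ≡ step i (g x) u)
        where

        -- `p` relates `u` to `last x`, not to `g x`. Both agree on the closed formulas that `Rᶜ`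
        -- consults, so the move is available at `g x` as well and `step` does not take its junk
        -- value.
        g-step : ∀ x t u p → b ≤ t → R i (g x) (g (move x t u p))
        g-step x t u p b≤t = subst (R i (g x)) (sym (g-move x t u p b≤t))
          (step-R i (g x) u (Rᶜ-≲ i (g x) (last x) u (g-≲ x) p))

        g-⊑ : ∀ {x y} → x ⊑[ b ] y → x ≡ y ⊎ R i (g x) (g y)
        g-⊑ stay = inj₁ refl
        g-⊑ (push {y} {t} {u} {p} x⊑y b≤t) with g-⊑ x⊑y
        ... | inj₁ refl = inj₂ (g-step y t u p b≤t)
        ... | inj₂ r    = inj₂ (R-trans i (g _) (g y) (g _) r (g-step y t u p b≤t))

        □⇒τd : ∀ x {A} → g x ∋ □ i A → (λ y → Lift ℓ (g y ∋ A)) ∈ τd (moves i) x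
        □⇒τd x {A} □A = cone-∈τd b x λ { (x⊑y , x≢y) → lift (go (g-⊑ x⊑y) x≢y) }
          where
          go : ∀ {y} → x ≡ y ⊎ R i (g x) (g y) → x ≢ y → g y ∋ A
          go (inj₁ x≡y) x≢y = contradiction x≡y x≢y
          go (inj₂ r)   _   = r A □A

        τd⇒□ : ∀ x {A} → (λ y → Lift ℓ (g y ∋ A)) ∈ τd (moves i) x → g x ∋ □ i A
        τd⇒□ x {A} U∈ with ∋-dec (g x) (□ i A) | ∈τd-cone x U∈
        ... | inj₁ □A  | _ = □A
        ... | inj₂ ¬□A | k , cone⊆
          with □-witness i (g x) {A} (λ □A → ∌⊥ (g x) (∋-mp (g x) ¬□A □A))
        -- `u` is a true successor of `g x`, so the move towards `u` reaches `u` itself and not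
        -- merely a world of its fibre.
        ... | u , r , u∌A = contradiction
          (subst (_∋ A) (trans (g-move x t u p (ℕ.m≤n⊔m k b)) (step-R≡ i (g x) u r))
            (lower (cone⊆ (push stay (ℕ.m≤m⊔n k b) , move-≢ x t u p))))
          u∌A
          where
          t : ℕ
          -- Time at least `k` keeps the new point in the cone; time at least `b` lets `g-move`
          -- compute its image.
          t = k ⊔ₙ b
          p : Rᶜ i (last x) u
          p = Rᶜ-≲ i (last x) (g x) u (≲-sym (g x) (last x) (g-≲ x)) (λ B _ → r B)

      -- Merged execution of two move sequences

      state : Point 0F → Point 1F → World
      state root           root           = w₀
      state (move x _ u _) root           = step 0F (state x root) u
      state root           (move y _ u _) = step 1F (state root y) u
      state (move x t u p) (move y t′ u′ p′) =
        -- The later of the two last moves is executed last; on equal times this is the move of `x`.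
        if t <ᵇ t′ then step 1F (state (move x t u p) y) u′
                   else step 0F (state x (move y t′ u′ p′)) u

      -- Closed formulas of `□₁` agree with `u` by the choice of `step`, and those of `□₂` are
      -- preserved along `R 0F` by `R-≲`.
      step₁-≲ : ∀ {w u} x y → w ≲[ 1F ] last x → w ≲[ 0F ] last {1F} y → Rᶜ 0F (last {0F} x) u →
                step 0F w u ≲[ 1F ] u × step 0F w u ≲[ 0F ] last y
      step₁-≲ {w} {u} x y w≲x w≲y p = step-≲ 0F w u p′ ,
        ≲-trans (step 0F w u) w (last y) (≲-sym w (step 0F w u) (R-≲ 0F w (step 0F w u) (step-R 0F w u p′))) w≲y
        where
        p′ : Rᶜ 0F w u
        p′ = Rᶜ-≲ 0F w (last x) u w≲x p

      step₂-≲ : ∀ {w u} x y → w ≲[ 1F ] last {0F} x → w ≲[ 0F ] last y → Rᶜ 1F (last {1F} y) u →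
                step 1F w u ≲[ 1F ] last x × step 1F w u ≲[ 0F ] u
      step₂-≲ {w} {u} x y w≲x w≲y p =
        ≲-trans (step 1F w u) w (last x) (≲-sym w (step 1F w u) (R-≲ 1F w (step 1F w u) (step-R 1F w u p′))) w≲x ,
        step-≲ 1F w u p′
        where
        p′ : Rᶜ 1F w u
        p′ = Rᶜ-≲ 1F w (last y) u w≲y p

      -- The invariant that makes availability independent of the other coordinate: `Rᶜ` at
      -- `state x y` sees only formulas on which this world agrees with the coordinate that moves.
      state-≲ : ∀ x y → state x y ≲[ 1F ] last x × state x y ≲[ 0F ] last y
      state-≲ root root = (λ _ → id) , (λ _ → id)
      state-≲ (move x t u p) root = let (a , b) = state-≲ x root in step₁-≲ x root a b p
      state-≲ root (move y t u p) = let (a , b) = state-≲ root y in step₂-≲ root y a b p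
      state-≲ (move x t u p) (move y t′ u′ p′) 
        with t <ᵇ t′ | state-≲ (move x t u p) y | state-≲ x (move y t′ u′ p′)
      ... | true  | a , b | _     = step₂-≲ (move x t u p) y a b p′
      ... | false | _     | a , b = step₁-≲ x (move y t′ u′ p′) a b p

      -- The successor forces new moves to be strictly later than the last one. Vertical moves
      -- require it, since on equal times `state` executes the horizontal move last.
      horizon : ∀ {i} → Point i → ℕ
      horizon root           = 0
      horizon (move _ t _ _) = suc t

      state-move₁ : ∀ y x t u p → horizon y ≤ t → state (move x t u p) y ≡ step 0F (state x y) u
      state-move₁ root              x t u p _    = refl
      state-move₁ (move y t′ u′ p′) x t u p t′<t
        rewrite dec-false (t ℕ.<? t′) (ℕ.<-asym t′<t) = refl

      state-move₂ : ∀ x y t u p → horizon x ≤ t → state x (move y t u p) ≡ step 1F (state x y) u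
      state-move₂ root              y t u p _    = refl
      state-move₂ (move x t′ u′ p′) y t u p t′<t
        rewrite dec-true (t′ ℕ.<? t) t′<t = refl

      module Row (y : Point 1F) = Slice 0F (λ x → state x y) (horizon y)
        (λ x → proj₁ (state-≲ x y)) (state-move₁ y)
      module Column (x : Point 0F) = Slice 1F (state x) (horizon x)
        (λ y → proj₂ (state-≲ x y)) (state-move₂ x)

      private
        F : NFrame 2 ℓ
        F = 𝒩d (moves 0F) ⊗ 𝒩d (moves 1F)

        V : Valuation F
        V p (x , y) = Lift ℓ (state x y ∋ var p)

      -- In the box cases a neighbourhood of the pair is determined by its trace on one row or
      -- column, where `Row` and `Column` supply both halves of the bounded morphism condition.
      truth : ∀ A x y → (x , y) ∈ ⟦ F ⟧ A V ⇔ state x y ∋ A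
      truth (var p) x y = mk⇔ (λ a → lower (lower a)) (λ a → lift (lift a))
      truth ⊥       x y = mk⇔ (λ ()) (λ a → contradiction a (∌⊥ (state x y)))
      truth (A ⇒ B) x y = mk⇔
        (λ f → ∋-⇒ (state x y) A B (λ a → B′.to (f (A′.from a))))
        (λ f a → B′.from (∋-mp (state x y) f (A′.to a)))
        where module A′ = Equivalence (truth A x y)
              module B′ = Equivalence (truth B x y)
      truth (□ 0F A) x y = mk⇔
        (λ (U , (W , W∈ , W⊆) , U⊆) → Row.τd⇒□ y x
          (IsFilter.upward (τd-isFilter (moves 0F) x)
            (λ {x′} w → lift (Equivalence.to (truth A x′ y) (U⊆ (W⊆ (w , refl))))) W∈))
        (λ □A → ((λ x′ → Lift ℓ (state x′ y ∋ A)) ⟨×⟩ ｛ y ｝) , (_ , Row.□⇒τd y x □A , λ {_} z → z) ,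
          λ { {x′ , _} (lift a , refl) → Equivalence.from (truth A x′ y) a })
      truth (□ 1F A) x y = mk⇔
        (λ (U , (W , W∈ , W⊆) , U⊆) → Column.τd⇒□ x y
          (IsFilter.upward (τd-isFilter (moves 1F) y)
            (λ {y′} w → lift (Equivalence.to (truth A x y′) (U⊆ (W⊆ (refl , w))))) W∈))
        (λ □A → (｛ x ｝ ⟨×⟩ (λ y′ → Lift ℓ (state x y′ ∋ A))) , (_ , Column.□⇒τd x y □A , λ {_} z → z) ,
          λ { {_ , y′} (refl , lift a) → Equivalence.from (truth A x y′) a })

    complete : ∀ {L₁ L₂ : Pred (Formula 1) 0ℓ} ℓ →
      (∀ w₀ → Moves.moves ℓ w₀ 0F ⊨d L₁) → (∀ w₀ → Moves.moves ℓ w₀ 1F ⊨d L₂) →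
      (L₁ ×d[ ℓ ] L₂) ⊆ L
    complete ℓ ⊨L₁ ⊨L₂ {A} a with em {P = A ∈ L}
    ... | yes A∈L = A∈L
    ... | no  A∉L with separate L-theory A∉L
    ...   | w₀ , _ , w₀∌A = contradiction
      -- `state root root` computes to `w₀`, where `A` fails.
      (Equivalence.to (truth A root root) (a (moves 0F) (moves 1F) (⊨L₁ w₀) (⊨L₂ w₀) _ (root , root)))
      w₀∌A
      where open Moves ℓ w₀

  -- Fusions of transitive logics and the four equalities

  module _
    (L₁ L₂ : Pred (Formula 1) 0ℓ)
    (four₁ : (□₁ var 0 ⇒ □₁ □₁ var 0) ∈ L₁) (four₂ : (□₁ var 0 ⇒ □₁ □₁ var 0) ∈ L₂)
    where
    private
      isL : IsLogic ⟨ L₁ , L₂ ⟩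
      isL = Least-isLogic _
      relabel₁ : ∀ {A} → A ∈ L₁ → relabel (λ _ → 0F) A ∈ ⟨ L₁ , L₂ ⟩
      relabel₁ a = ax (inj₁ (ax (inj₁ (ax (inj₂ (_ , a , refl))))))
      relabel₂ : ∀ {A} → A ∈ L₂ → relabel (λ _ → 1F) A ∈ ⟨ L₁ , L₂ ⟩
      relabel₂ a = ax (inj₁ (ax (inj₂ (_ , a , refl))))

      four : ∀ i A → □ i A ⇒ □ i (□ i A) ∈ ⟨ L₁ , L₂ ⟩
      four 0F A = IsLogic.sub isL (λ _ → A) (relabel₁ four₁)
      four 1F A = IsLogic.sub isL (λ _ → A) (relabel₂ four₂)

      persist : ∀ i A → Closed A → BoxFree i A → A ⇒ □ i A ∈ ⟨ L₁ , L₂ ⟩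
      -- The first half of `Δ` introduces `□₂` and the second `□₁`, hence the crossed injections.
      persist 0F A c f = ax (inj₂ (inj₂ (A , c , f , refl)))
      persist 1F A c f = ax (inj₂ (inj₁ (A , c , f , refl)))

    module Can = Canonical ⟨ L₁ , L₂ ⟩ isL four persist

    moves-D4₁ : ¬ᶠ (□₁ ⊥) ∈ L₁ → ∀ ℓ w₀ → Can.Moves.moves ℓ w₀ 0F ⊨d D4
    moves-D4₁ d ℓ w₀ = Can.Moves.moves-D4 ℓ w₀ 0F (relabel₁ d)

    moves-D4₂ : ¬ᶠ (□₁ ⊥) ∈ L₂ → ∀ ℓ w₀ → Can.Moves.moves ℓ w₀ 1F ⊨d D4
    moves-D4₂ d ℓ w₀ = Can.Moves.moves-D4 ℓ w₀ 1F (relabel₂ d)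

four-K4 : (□₁ var 0 ⇒ □₁ □₁ var 0) ∈ K4
four-K4 = ax (inj₂ refl)

four-D4 : (□₁ var 0 ⇒ □₁ □₁ var 0) ∈ D4
four-D4 = ax (inj₁ four-K4)

serial-D4 : ¬ᶠ (□₁ ⊥) ∈ D4
serial-D4 = ax (inj₂ refl)

⟨D4,D4⟩⊆D4*D4 : ⟨ D4 , D4 ⟩ ⊆ (D4 * D4)
⟨D4,D4⟩⊆D4*D4 = Least-minimal isL λ
  { (inj₁ a) → a
  ; (inj₂ (inj₁ (B , c , _ , refl))) → closed⇒□ isL serial 1F B c
  ; (inj₂ (inj₂ (B , c , _ , refl))) → closed⇒□ isL serial 0F B c
  }
  where
  isL : IsLogic (D4 * D4)
  isL = Least-isLogic _
  serial : ∀ i → ¬ᶠ (□ i ⊥) ∈ (D4 * D4)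
  serial 0F = ax (inj₁ (ax (inj₂ (_ , serial-D4 , refl))))
  serial 1F = ax (inj₂ (_ , serial-D4 , refl))

theorem9p1 : (∀ {a} → ExcludedMiddle a) →
    (ℓ : Level) →
    ((K4 ×d[ ℓ ] K4) ≐ ⟨ K4 , K4 ⟩)
    × ((K4 ×d[ ℓ ] D4) ≐ ⟨ K4 , D4 ⟩)
    × ((D4 ×d[ ℓ ] K4) ≐ ⟨ D4 , K4 ⟩)
    × ((D4 ×d[ ℓ ] D4) ≐ (D4 * D4))
theorem9p1 em ℓ =
    (KK.complete ℓ (λ w → KK.Moves.moves-K4 ℓ w 0F) (λ w → KK.Moves.moves-K4 ℓ w 1F) ,
      ⟨,⟩-sound em K4 K4 ℓ)
  , (KD.complete ℓ (λ w → KD.Moves.moves-K4 ℓ w 0F)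
        (moves-D4₂ em K4 D4 four-K4 four-D4 serial-D4 ℓ) ,
      ⟨,⟩-sound em K4 D4 ℓ)
  , (DK.complete ℓ (moves-D4₁ em D4 K4 four-D4 four-K4 serial-D4 ℓ)
        (λ w → DK.Moves.moves-K4 ℓ w 1F) ,
      ⟨,⟩-sound em D4 K4 ℓ)
  , (⟨D4,D4⟩⊆D4*D4 ∘ DD.complete ℓ (moves-D4₁ em D4 D4 four-D4 four-D4 serial-D4 ℓ)
        (moves-D4₂ em D4 D4 four-D4 four-D4 serial-D4 ℓ) ,
      λ a → ⟨,⟩-sound em D4 D4 ℓ (ax (inj₁ a)))
  where
  module KK = Can em K4 K4 four-K4 four-K4
  module KD = Can em K4 D4 four-K4 four-D4
  module DK = Can em D4 K4 four-D4 four-K4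
  module DD = Can em D4 D4 four-D4 four-D4
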